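{- Let $X\subseteq\mathbb{Z}^2\setminus\{O\}$ be an arbitrary step set, and let $\mathcal{C}$ be a submonoid of $\mathbb{Z}^2$. Then $\mathcal{A}_X^{\mathcal{C}}$ is a non-trivial group if and only if $O$ belongs to the relative interior of $\operatorname{Conv}(\mathcal{A}_X^{\mathcal{C}}\setminus\{O\})$.
   Context: Write $O=(0,0)$. A step set is any (finite or infinite) subset $X$ of $\mathbb{Z}^2\setminus\{O\}$. $\mathcal{F}_X$ is the free monoid on $X$ (all finite words over $X$, including the empty word), with $\ell(w)$ the length of $w$; for $w=A_1\cdots A_k\in\mathcal{F}_X$ put $\alpha_X(w)=A_1+\cdots+A_k$ and, for $0\le m\le k$, $\sigma_m(w)=A_1\cdots A_m$. For a submonoid $\mathcal{C}$ of $\mathbb{Z}^2$, define $\mathcal{F}_X^{\mathcal{C}}=\{w\in\mathcal{F}_X:\alpha_X(\sigma_m(w))\in\mathcal{C}\text{ for all }0\le m\le\ell(w)\}$ and $\mathcal{A}_X^{\mathcal{C}}=\alpha_X(\mathcal{F}_X^{\mathcal{C}})$, which is a submonoid of $\mathbb{Z}^2$. $\operatorname{Conv}$ denotes convex hull in $\mathbb{R}^2$. The relative interior of a subset $U\subseteq\mathbb{R}^2$ is its interior relative to the smallest affine subspace of $\mathbb{R}^2$ containing $U$ (the relative interior of the empty set is empty). -}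

module Defs where

open import Data.Integer using (ℤ; 0ℤ)
import Data.Integer as ℤ
open import Data.List using (List; foldr; length; take)
open import Data.List.Relation.Unary.All using (All)
open import Data.Nat using (ℕ)
import Data.Nat as ℕ
import Data.Nat.Properties as ℕ
open import Data.Product using (∃; _×_; _,_)
open import Data.Rational hiding (_⊔_)
open import Data.Rational.Properties
open import Data.Rational.Solver using (module +-*-Solver)
open import Level using (Level; _⊔_)
open import Relation.Binary.PropositionalEquality
  using (_≡_; refl; sym; trans; cong; cong₂; subst)
open import Relation.Unary using (Pred; _∈_; _∉_; _∖_; ｛_｝)

private
  variable
    a b ℓ : Level

------------------------------------------------------------------------
-- Real numbers, as Cauchy sequences of rationals up to _≈ᴿ_

Eventually : Pred ℕ ℓ → Set ℓ
Eventually P = ∃ λ N → ∀ n → N ℕ.≤ n → P n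

IsCauchy : (ℕ → ℚ) → Set
IsCauchy s = ∀ ε → 0ℚ < ε →
  ∃ λ N → ∀ m n → N ℕ.≤ m → N ℕ.≤ n → ∣ s m - s n ∣ < ε

record ℝ : Set where
  constructor mkℝ
  field
    seq    : ℕ → ℚ
    cauchy : IsCauchy seq

open ℝ public

infix 4 _≈ᴿ_ _<ᴿ_ _≤ᴿ_

_≈ᴿ_ : ℝ → ℝ → Set
x ≈ᴿ y = ∀ ε → 0ℚ < ε → Eventually λ n → ∣ seq x n - seq y n ∣ < ε

_<ᴿ_ : ℝ → ℝ → Set
x <ᴿ y = ∃ λ ε → 0ℚ < ε × Eventually λ n → seq x n + ε < seq y n

_≤ᴿ_ : ℝ → ℝ → Set
x ≤ᴿ y = ∀ ε → 0ℚ < ε → Eventually λ n → seq x n < seq y n + ε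

abstract
  0<½* : ∀ {ε} → 0ℚ < ε → 0ℚ < ½ * ε
  0<½* {ε} 0<ε = subst (_< ½ * ε) (*-zeroʳ ½) (*-monoʳ-<-pos ½ 0<ε)

  halves : ∀ ε → ½ * ε + ½ * ε ≡ ε
  halves ε = trans (sym (*-distribʳ-+ ε ½ ½)) (*-identityˡ ε)

  const-cauchy : ∀ q → IsCauchy (λ _ → q)
  const-cauchy q ε 0<ε =
    0 , λ _ _ _ _ → subst (λ r → ∣ r ∣ < ε) (sym (+-inverseʳ q)) 0<ε

  +-cauchy : ∀ {s t} → IsCauchy s → IsCauchy t → IsCauchy (λ n → s n + t n)
  +-cauchy {s} {t} cs ct ε 0<ε
    with cs (½ * ε) (0<½* 0<ε) | ct (½ * ε) (0<½* 0<ε)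
  ... | M , hs | N , ht = M ℕ.⊔ N , λ m n m≥ n≥ → begin-strict
      ∣ (s m + t m) - (s n + t n) ∣
        ≡⟨ cong ∣_∣ (regroup (s m) (t m) (s n) (t n)) ⟩
      ∣ (s m - s n) + (t m - t n) ∣
        ≤⟨ ∣p+q∣≤∣p∣+∣q∣ (s m - s n) (t m - t n) ⟩
      ∣ s m - s n ∣ + ∣ t m - t n ∣
        <⟨ +-mono-< (hs m n (ℕ.m⊔n≤o⇒m≤o M N m≥) (ℕ.m⊔n≤o⇒m≤o M N n≥))
                    (ht m n (ℕ.m⊔n≤o⇒n≤o M N m≥) (ℕ.m⊔n≤o⇒n≤o M N n≥)) ⟩
      ½ * ε + ½ * ε
        ≡⟨ halves ε ⟩
      ε ∎
    where
    open ≤-Reasoning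
    regroup : ∀ u v w z → (u + v) - (w + z) ≡ (u - w) + (v - z)
    regroup = solve 4 (λ u v w z →
      (u :+ v) :- (w :+ z) := (u :- w) :+ (v :- z)) refl
      where open +-*-Solver

  neg-cauchy : ∀ {s} → IsCauchy s → IsCauchy (λ n → - s n)
  neg-cauchy {s} cs ε 0<ε with cs ε 0<ε
  ... | N , hs = N , λ m n m≥ n≥ →
    subst (_< ε) (trans (sym (∣-p∣≡∣p∣ (s m - s n)))
                        (cong ∣_∣ (neg-distrib-+ (s m) (- s n))))
          (hs m n m≥ n≥)

  bounded : ∀ {s} → IsCauchy s →
            ∃ λ B → 0ℚ < B × Eventually λ n → ∣ s n ∣ < B
  bounded {s} cs with cs 1ℚ (positive⁻¹ 1ℚ)
  ... | N , hs =
    1ℚ + ∣ s N ∣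
    , +-mono-<-≤ (positive⁻¹ 1ℚ) (0≤∣p∣ (s N))
    , N , λ n n≥ → begin-strict
        ∣ s n ∣                     ≡⟨ cong ∣_∣ (regroup (s n) (s N)) ⟩
        ∣ (s n - s N) + s N ∣       ≤⟨ ∣p+q∣≤∣p∣+∣q∣ (s n - s N) (s N) ⟩
        ∣ s n - s N ∣ + ∣ s N ∣     <⟨ +-monoˡ-< ∣ s N ∣ (hs n N n≥ ℕ.≤-refl) ⟩
        1ℚ + ∣ s N ∣                ∎
    where
    open ≤-Reasoning
    regroup : ∀ u v → u ≡ (u - v) + v
    regroup = solve 2 (λ u v → u := (u :- v) :+ v) refl
      where open +-*-Solver

  ∣*∣-< : ∀ p q {B δ} → 0ℚ < B → ∣ p ∣ < B → ∣ q ∣ < δ → ∣ p * q ∣ < B * δ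
  ∣*∣-< p q {B} {δ} 0<B p< q< = begin-strict
      ∣ p * q ∣        ≡⟨ ∣p*q∣≡∣p∣*∣q∣ p q ⟩
      ∣ p ∣ * ∣ q ∣    ≤⟨ *-monoʳ-≤-nonNeg ∣ q ∣ {{nonNegative (0≤∣p∣ q)}} (<⇒≤ p<) ⟩
      B * ∣ q ∣        <⟨ *-monoʳ-<-pos B {{positive 0<B}} q< ⟩
      B * δ            ∎
    where open ≤-Reasoning

  divide : ∀ {B ε} → 0ℚ < B → 0ℚ < ε → ∃ λ δ → 0ℚ < δ × B * δ ≡ ε
  divide {B} {ε} 0<B 0<ε =
    1/ B * ε
    , subst (_< 1/ B * ε) (*-zeroʳ (1/ B)) (*-monoʳ-<-pos (1/ B) 0<ε)
    , trans (sym (*-assoc B (1/ B) ε))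
            (trans (cong (_* ε) (*-inverseʳ B)) (*-identityˡ ε))
    where
    instance
      B>0 : Positive B
      B>0 = positive 0<B
      B≢0 : NonZero B
      B≢0 = pos⇒nonZero B
      1/B>0 : Positive (1/ B)
      1/B>0 = 1/pos⇒pos B

  product-diff-< : ∀ s t s′ t′ {B C δ η ε} → 0ℚ < B → 0ℚ < C →
    ∣ s ∣ < B → ∣ t′ ∣ < C → ∣ t - t′ ∣ < δ → ∣ s - s′ ∣ < η →
    B * δ ≡ ½ * ε → C * η ≡ ½ * ε → ∣ s * t - s′ * t′ ∣ < ε
  product-diff-< s t s′ t′ {B} {C} {δ} {η} {ε} 0<B 0<C s< t′< Δt< Δs< Bδ Cη =
    begin-strict
      ∣ s * t - s′ * t′ ∣
        ≡⟨ cong ∣_∣ (regroup s t s′ t′) ⟩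
      ∣ s * (t - t′) + t′ * (s - s′) ∣
        ≤⟨ ∣p+q∣≤∣p∣+∣q∣ (s * (t - t′)) (t′ * (s - s′)) ⟩
      ∣ s * (t - t′) ∣ + ∣ t′ * (s - s′) ∣
        <⟨ +-mono-< (∣*∣-< s (t - t′) 0<B s< Δt<) (∣*∣-< t′ (s - s′) 0<C t′< Δs<) ⟩
      B * δ + C * η
        ≡⟨ cong₂ _+_ Bδ Cη ⟩
      ½ * ε + ½ * ε
        ≡⟨ halves ε ⟩
      ε ∎
    where
    open ≤-Reasoning
    regroup : ∀ u v w z → u * v - w * z ≡ u * (v - z) + z * (u - w)
    regroup = solve 4 (λ u v w z →
      u :* v :- w :* z := u :* (v :- z) :+ z :* (u :- w)) refl
      where open +-*-Solver

  *-cauchy : ∀ {s t} → IsCauchy s → IsCauchy t → IsCauchy (λ n → s n * t n)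
  *-cauchy {s} {t} cs ct ε 0<ε =
    let B , 0<B , K , hB = bounded cs
        C , 0<C , L , hC = bounded ct
        δ , 0<δ , Bδ = divide 0<B (0<½* 0<ε)
        η , 0<η , Cη = divide 0<C (0<½* 0<ε)
        M , ht = ct δ 0<δ
        N , hs = cs η 0<η
    in (K ℕ.⊔ L) ℕ.⊔ (M ℕ.⊔ N) , λ m n m≥ n≥ →
    let m≥KL = ℕ.m⊔n≤o⇒m≤o (K ℕ.⊔ L) (M ℕ.⊔ N) m≥
        n≥KL = ℕ.m⊔n≤o⇒m≤o (K ℕ.⊔ L) (M ℕ.⊔ N) n≥
        m≥MN = ℕ.m⊔n≤o⇒n≤o (K ℕ.⊔ L) (M ℕ.⊔ N) m≥
        n≥MN = ℕ.m⊔n≤o⇒n≤o (K ℕ.⊔ L) (M ℕ.⊔ N) n≥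
    in product-diff-< (s m) (t m) (s n) (t n) 0<B 0<C
         (hB m (ℕ.m⊔n≤o⇒m≤o K L m≥KL))
         (hC n (ℕ.m⊔n≤o⇒n≤o K L n≥KL))
         (ht m n (ℕ.m⊔n≤o⇒m≤o M N m≥MN) (ℕ.m⊔n≤o⇒m≤o M N n≥MN))
         (hs m n (ℕ.m⊔n≤o⇒n≤o M N m≥MN) (ℕ.m⊔n≤o⇒n≤o M N n≥MN))
         Bδ Cη

fromℚ : ℚ → ℝ
fromℚ q = mkℝ (λ _ → q) (const-cauchy q)

fromℤ : ℤ → ℝ
fromℤ i = fromℚ (i / 1)

0ᴿ 1ᴿ : ℝ
0ᴿ = fromℚ 0ℚ
1ᴿ = fromℚ 1ℚ

infixl 6 _+ᴿ_ _-ᴿ_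
infixl 7 _*ᴿ_
infix  8 -ᴿ_

_+ᴿ_ : ℝ → ℝ → ℝ
x +ᴿ y = mkℝ (λ n → seq x n + seq y n)
             (+-cauchy {seq x} {seq y} (cauchy x) (cauchy y))

-ᴿ_ : ℝ → ℝ
-ᴿ x = mkℝ (λ n → - seq x n) (neg-cauchy {seq x} (cauchy x))

_-ᴿ_ : ℝ → ℝ → ℝ
x -ᴿ y = x +ᴿ (-ᴿ y)

_*ᴿ_ : ℝ → ℝ → ℝ
x *ᴿ y = mkℝ (λ n → seq x n * seq y n)
             (*-cauchy {seq x} {seq y} (cauchy x) (cauchy y))

------------------------------------------------------------------------
-- The plane

ℝ² : Set
ℝ² = ℝ × ℝ

infix 4 _≈²_
_≈²_ : ℝ² → ℝ² → Set
(x₁ , x₂) ≈² (y₁ , y₂) = x₁ ≈ᴿ y₁ × x₂ ≈ᴿ y₂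

-- The point (1 - t) p + t q.
lineAt : ℝ → ℝ² → ℝ² → ℝ²
lineAt t (p₁ , p₂) (q₁ , q₂) =
    (1ᴿ -ᴿ t) *ᴿ p₁ +ᴿ t *ᴿ q₁
  , (1ᴿ -ᴿ t) *ᴿ p₂ +ᴿ t *ᴿ q₂

distSq : ℝ² → ℝ² → ℝ
distSq (p₁ , p₂) (q₁ , q₂) =
  (p₁ -ᴿ q₁) *ᴿ (p₁ -ᴿ q₁) +ᴿ (p₂ -ᴿ q₂) *ᴿ (p₂ -ᴿ q₂)

-- The least convex set containing U.  Since ℝ is a setoid, `resp` is what
-- makes this a subset of the plane.
data Conv (U : Pred ℝ² ℓ) : Pred ℝ² ℓ where
  incl    : ∀ {p} → p ∈ U → p ∈ Conv U
  segment : ∀ {p q} t → 0ᴿ ≤ᴿ t → t ≤ᴿ 1ᴿ →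
            p ∈ Conv U → q ∈ Conv U → lineAt t p q ∈ Conv U
  resp    : ∀ {p q} → p ≈² q → p ∈ Conv U → q ∈ Conv U

-- The least affine subspace containing U: an affine subspace is a set that
-- contains the line through any two of its points (so it may be empty).
data Aff (U : Pred ℝ² ℓ) : Pred ℝ² ℓ where
  incl : ∀ {p} → p ∈ U → p ∈ Aff U
  line : ∀ {p q} t → p ∈ Aff U → q ∈ Aff U → lineAt t p q ∈ Aff U
  resp : ∀ {p q} → p ≈² q → p ∈ Aff U → q ∈ Aff U

RelInt : Pred ℝ² ℓ → Pred ℝ² ℓ
RelInt U p = p ∈ Aff U ×
  (∃ λ ε → 0ᴿ <ᴿ ε × (∀ q → q ∈ Aff U → distSq p q <ᴿ ε *ᴿ ε → q ∈ U))

------------------------------------------------------------------------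
-- The lattice

ℤ² : Set
ℤ² = ℤ × ℤ

O : ℤ²
O = 0ℤ , 0ℤ

infixl 6 _⊕_
_⊕_ : ℤ² → ℤ² → ℤ²
(x₁ , x₂) ⊕ (y₁ , y₂) = x₁ ℤ.+ y₁ , x₂ ℤ.+ y₂

⊖_ : ℤ² → ℤ²
⊖ (x₁ , x₂) = ℤ.- x₁ , ℤ.- x₂

toℝ² : ℤ² → ℝ²
toℝ² (x₁ , x₂) = fromℤ x₁ , fromℤ x₂

-- A set of lattice points, regarded as a subset of the plane.
⟦_⟧ : Pred ℤ² ℓ → Pred ℝ² ℓ
⟦ S ⟧ p = ∃ λ x → x ∈ S × toℝ² x ≈² p

record IsSubmonoid (S : Pred ℤ² ℓ) : Set ℓ where
  field
    O∈       : O ∈ S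
    ⊕-closed : ∀ {x y} → x ∈ S → y ∈ S → x ⊕ y ∈ S

record IsSubgroup (S : Pred ℤ² ℓ) : Set ℓ where
  field
    isSubmonoid : IsSubmonoid S
    ⊖-closed    : ∀ {x} → x ∈ S → ⊖ x ∈ S

NonTrivial : Pred ℤ² ℓ → Set ℓ
NonTrivial S = ∃ λ x → x ∈ S ∖ ｛ O ｝

------------------------------------------------------------------------
-- Constrained walks

StepSet : Pred ℤ² ℓ → Set ℓ
StepSet X = O ∉ X

α : List ℤ² → ℤ²
α = foldr _⊕_ O

σ : ℕ → List ℤ² → List ℤ²
σ = take

-- The free monoid on X, as the set of words over ℤ² all of whose letters
-- lie in X.
𝓕 : Pred ℤ² a → Pred (List ℤ²) a
𝓕 X = All X

𝓕[_,_] : Pred ℤ² a → Pred ℤ² b → Pred (List ℤ²) (a ⊔ b)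
𝓕[ X , C ] w = w ∈ 𝓕 X × (∀ m → m ℕ.≤ length w → α (σ m w) ∈ C)

𝓐[_,_] : Pred ℤ² a → Pred ℤ² b → Pred ℤ² (a ⊔ b)
𝓐[ X , C ] x = ∃ λ w → w ∈ 𝓕[ X , C ] × α w ≡ x

{-# OPTIONS --safe #-}

-- (⇒) If two elements x, y of the group A are independent, then Conv(A ∖ {O})
-- contains the parallelogram { s x + t y : |s|, |t| ≤ ½ }; otherwise A spans
-- a line ℝ x, and Conv(A ∖ {O}) contains the segment from - x to x.
--
-- (⇐) Let x ∈ A ∖ {O}.  As O is a relative interior point, - δ x lies in
-- Conv(A ∖ {O}) for some δ > 0.  If - x ∉ A, then no z ∈ A points in the
-- direction of - x, since - x = |x|² z + (- x·z - 1) x whenever det(x, z) = 0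
-- and x·z < 0; nor can two elements of A on different sides of ℝ x have a
-- positive combination in that direction.  Hence every finite part of A lies in
-- a closed half-plane z·f ≥ 0 with x·f > 0.  The point - δ x is in the hull of
-- such a finite part, a contradiction.

module Submission where

open import Defs
open import Axiom.ExcludedMiddle using (ExcludedMiddle)
open import Data.Integer using (ℤ; 0ℤ; 1ℤ)
import Data.Integer as ℤ
import Data.Integer.Properties as ℤ
import Data.Integer.Tactic.RingSolver as ℤ-Solver
open import Data.List using (List; []; _∷_; _++_; length; take)
import Data.List.Extrema
import Data.List.Properties as List
open import Data.List.Relation.Unary.All as All using (All; []; _∷_)
import Data.List.Relation.Unary.All.Properties as All
open import Data.Maybe using (Maybe; just; nothing)
open import Data.Nat using (ℕ; zero; suc; z≤n; s≤s)
import Data.Nat as ℕ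
import Data.Nat.Coprimality as Coprime
import Data.Nat.Properties as ℕ
open import Data.Product using (∃; _×_; _,_; proj₁; proj₂)
open import Data.Product.Properties using (≡-dec)
open import Data.Rational hiding (_⊔_)
open import Data.Rational.Properties
open import Data.Sum using (inj₁; inj₂)
open import Function using (_∘_)
open import Function.Bundles using (_⇔_; mk⇔)
open import Level using (Level; 0ℓ; _⊔_)
open import Relation.Binary.Bundles using (DecTotalOrder)
open import Relation.Binary.Definitions using (tri<; tri≈; tri>)
open import Relation.Binary.PropositionalEquality
  using (_≡_; _≢_; refl; sym; trans; cong; cong₂; subst; subst₂; module ≡-Reasoning)
open import Relation.Nullary using (yes; no; contradiction)
open import Relation.Nullary.Decidable using (decidable-stable)
open import Relation.Unary using (Pred; _∈_; _∉_; _⊆_; _∩_; _∖_; ｛_｝)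
open import Tactic.RingSolver using (solve-∀)
open import Tactic.RingSolver.Core.AlmostCommutativeRing
  using (AlmostCommutativeRing; fromCommutativeRing)

private
  variable
    a b ℓ ℓ′ : Level

-- Lattice geometry

dot det : ℤ² → ℤ² → ℤ
dot (x₁ , x₂) (y₁ , y₂) = x₁ ℤ.* y₁ ℤ.+ x₂ ℤ.* y₂
det (x₁ , x₂) (y₁ , y₂) = x₁ ℤ.* y₂ ℤ.- x₂ ℤ.* y₁

infixr 7 _·_
_·_ : ℤ → ℤ² → ℤ²
k · (x₁ , x₂) = k ℤ.* x₁ , k ℤ.* x₂

0≤i*i : ∀ i → 0ℤ ℤ.≤ i ℤ.* i
0≤i*i (ℤ.+ zero)    = ℤ.+≤+ z≤n
0≤i*i (ℤ.+ (suc _)) = ℤ.+≤+ z≤n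
0≤i*i ℤ.-[1+ _ ]    = ℤ.+≤+ z≤n

0<i*i : ∀ i → i ≢ 0ℤ → 0ℤ ℤ.< i ℤ.* i
0<i*i (ℤ.+ zero)    i≢0 = contradiction refl i≢0
0<i*i (ℤ.+ (suc _)) _   = ℤ.+<+ (s≤s z≤n)
0<i*i ℤ.-[1+ _ ]    _   = ℤ.+<+ (s≤s z≤n)

dot-pos : ∀ x → O ≢ x → 0ℤ ℤ.< dot x x
dot-pos (x₁ , x₂) O≢x with x₁ ℤ.≟ 0ℤ | x₂ ℤ.≟ 0ℤ
... | no x₁≢0  | _        = ℤ.+-mono-<-≤ (0<i*i x₁ x₁≢0) (0≤i*i x₂)
... | yes _    | no x₂≢0  = ℤ.+-mono-≤-< (0≤i*i x₁) (0<i*i x₂ x₂≢0)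
... | yes refl | yes refl = contradiction refl O≢x

-- Constrained walks

α-++ : ∀ u v → α (u ++ v) ≡ α u ⊕ α v
α-++ []              v = sym (cong₂ _,_ (ℤ.+-identityˡ _) (ℤ.+-identityˡ _))
α-++ ((x₁ , x₂) ∷ u) v rewrite α-++ u v =
  sym (cong₂ _,_ (ℤ.+-assoc x₁ _ _) (ℤ.+-assoc x₂ _ _))

take-++ : ∀ {A : Set} m (u v : List A) →
          take m (u ++ v) ≡ take m u ++ take (m ℕ.∸ length u) v
take-++ zero    []      v = refl
take-++ (suc m) []      v = refl
take-++ zero    (x ∷ u) v = refl
take-++ (suc m) (x ∷ u) v = cong (x ∷_) (take-++ m u v)

-- Prefixes longer than `w` are `w` itself. With the length bound gone, a prefix of a concatenation
-- splits without a case distinction on where the cut falls.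
σ-clip : ∀ {C : Pred ℤ² b} {w} → (∀ m → m ℕ.≤ length w → α (σ m w) ∈ C) →
         ∀ m → α (σ m w) ∈ C
σ-clip {C = C} {w} h m with ℕ.≤-total m (length w)
... | inj₁ m≤ = h m m≤
... | inj₂ m≥ = subst (λ v → α v ∈ C)
  (trans (List.take-all _ w ℕ.≤-refl) (sym (List.take-all m w m≥)))
  (h (length w) ℕ.≤-refl)

-- A prefix of `u ++ v` is a prefix of `u` followed by a possibly empty prefix of `v`, so its
-- endpoint is a sum of two elements of `C`.
𝓐-isSubmonoid : ∀ {X : Pred ℤ² a} {C : Pred ℤ² b} →
                IsSubmonoid C → IsSubmonoid 𝓐[ X , C ]
𝓐-isSubmonoid {C = C} C-sub = record
  { O∈       = [] , ((All.[] , λ { zero _ → O∈ }) , refl)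
  ; ⊕-closed = λ { (u , (Xu , Cu) , refl) (v , (Xv , Cv) , refl) →
      u ++ v
      , (All.++⁺ Xu Xv , λ m _ →
          subst (_∈ C)
            (sym (trans (cong α (take-++ m u v)) (α-++ (take m u) _)))
            (⊕-closed (σ-clip {C = C} {u} Cu m) (σ-clip {C = C} {v} Cv (m ℕ.∸ length u))))
      , α-++ u v }
  }
  where open IsSubmonoid C-sub

-- Opposites in a submonoid of the lattice

module _ {S : Pred ℤ² ℓ} (S-sub : IsSubmonoid S) where

  open IsSubmonoid S-sub

  ·-closed : ∀ {k x} → 0ℤ ℤ.≤ k → x ∈ S → k · x ∈ S
  ·-closed {x = x} (ℤ.+≤+ {n = n} _) x∈S = go n
    where
    distrib : ∀ k i → i ℤ.+ k ℤ.* i ≡ (1ℤ ℤ.+ k) ℤ.* i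
    distrib = ℤ-Solver.solve-∀
    go : ∀ k → (ℤ.+ k) · x ∈ S
    go zero    = O∈
    go (suc k) = subst (_∈ S) (cong₂ _,_ (distrib (ℤ.+ k) _) (distrib (ℤ.+ k) _))
                              (⊕-closed x∈S (go k))

  -- The combination `|x|² z - (1 + x·z) x` differs from `- x` by a multiple of `det x z`.
  -- Integrality makes its second coefficient non-negative: `dot x z < 0` gives `1 + dot x z ≤ 0`.
  ⊖∈-of-opposite : ∀ {x z} → x ∈ S → z ∈ S → det x z ≡ 0ℤ → dot x z ℤ.< 0ℤ → ⊖ x ∈ S
  ⊖∈-of-opposite {x@(x₁ , x₂)} {z@(z₁ , z₂)} x∈S z∈S det≡0 dot<0 =
    subst (_∈ S)
      (cong₂ _,_
        (trans (first x₁ x₂ z₁ z₂) (trans (cong (λ d → ℤ.- x₁ ℤ.- x₂ ℤ.* d) det≡0) (drop₁ x₁ x₂)))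
        (trans (second x₁ x₂ z₁ z₂) (trans (cong (λ d → ℤ.- x₂ ℤ.+ x₁ ℤ.* d) det≡0) (drop₂ x₁ x₂))))
      (⊕-closed (·-closed (ℤ.+-mono-≤ (0≤i*i x₁) (0≤i*i x₂)) z∈S)
                (·-closed (ℤ.neg-mono-≤ (ℤ.i<j⇒suc[i]≤j dot<0)) x∈S))
    where
    first : ∀ x₁ x₂ z₁ z₂ →
      (x₁ ℤ.* x₁ ℤ.+ x₂ ℤ.* x₂) ℤ.* z₁ ℤ.+ (ℤ.- (1ℤ ℤ.+ (x₁ ℤ.* z₁ ℤ.+ x₂ ℤ.* z₂))) ℤ.* x₁
      ≡ ℤ.- x₁ ℤ.- x₂ ℤ.* (x₁ ℤ.* z₂ ℤ.- x₂ ℤ.* z₁)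
    first = ℤ-Solver.solve-∀
    second : ∀ x₁ x₂ z₁ z₂ →
      (x₁ ℤ.* x₁ ℤ.+ x₂ ℤ.* x₂) ℤ.* z₂ ℤ.+ (ℤ.- (1ℤ ℤ.+ (x₁ ℤ.* z₁ ℤ.+ x₂ ℤ.* z₂))) ℤ.* x₂
      ≡ ℤ.- x₂ ℤ.+ x₁ ℤ.* (x₁ ℤ.* z₂ ℤ.- x₂ ℤ.* z₁)
    second = ℤ-Solver.solve-∀
    drop₁ : ∀ i j → ℤ.- i ℤ.- j ℤ.* 0ℤ ≡ ℤ.- i
    drop₁ = ℤ-Solver.solve-∀
    drop₂ : ∀ i j → ℤ.- j ℤ.+ i ℤ.* 0ℤ ≡ ℤ.- j
    drop₂ = ℤ-Solver.solve-∀

  -- The element `z = det(x,u) v - det(x,v) u` has non-negative coefficients and `det x z` cancels.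
  -- The last hypothesis says that `dot x z < 0`, so `z` is opposite to `x`.
  ⊖∈-of-straddling : ∀ {x u v} → x ∈ S → u ∈ S → v ∈ S →
    0ℤ ℤ.< det x u → det x v ℤ.< 0ℤ →
    det x u ℤ.* dot x v ℤ.< det x v ℤ.* dot x u → ⊖ x ∈ S
  ⊖∈-of-straddling {x@(x₁ , x₂)} {u@(u₁ , u₂)} {v@(v₁ , v₂)} x∈S u∈S v∈S 0<du dv<0 lt =
    ⊖∈-of-opposite x∈S
      (⊕-closed (·-closed (ℤ.<⇒≤ 0<du) v∈S)
                (·-closed (ℤ.neg-mono-≤ (ℤ.<⇒≤ dv<0)) u∈S))
      (trans (det-combination x₁ x₂ u₁ u₂ v₁ v₂ (det x u) (det x v)) (cancel (det x u) (det x v)))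
      (subst (ℤ._< 0ℤ) (sym (dot-combination x₁ x₂ u₁ u₂ v₁ v₂ (det x u) (det x v)))
        (ℤ.≤∧≢⇒< (ℤ.i≤j⇒i-j≤0 (ℤ.<⇒≤ lt))
                 (λ eq → ℤ.<⇒≢ lt (ℤ.i-j≡0⇒i≡j _ _ eq))))
    where
    det-combination : ∀ x₁ x₂ u₁ u₂ v₁ v₂ k l →
      x₁ ℤ.* (k ℤ.* v₂ ℤ.+ ℤ.- l ℤ.* u₂) ℤ.- x₂ ℤ.* (k ℤ.* v₁ ℤ.+ ℤ.- l ℤ.* u₁)
      ≡ k ℤ.* (x₁ ℤ.* v₂ ℤ.- x₂ ℤ.* v₁) ℤ.- l ℤ.* (x₁ ℤ.* u₂ ℤ.- x₂ ℤ.* u₁)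
    det-combination = ℤ-Solver.solve-∀
    cancel : ∀ k l → k ℤ.* l ℤ.- l ℤ.* k ≡ 0ℤ
    cancel = ℤ-Solver.solve-∀
    dot-combination : ∀ x₁ x₂ u₁ u₂ v₁ v₂ k l →
      x₁ ℤ.* (k ℤ.* v₁ ℤ.+ ℤ.- l ℤ.* u₁) ℤ.+ x₂ ℤ.* (k ℤ.* v₂ ℤ.+ ℤ.- l ℤ.* u₂)
      ≡ k ℤ.* (x₁ ℤ.* v₁ ℤ.+ x₂ ℤ.* v₂) ℤ.- l ℤ.* (x₁ ℤ.* u₁ ℤ.+ x₂ ℤ.* u₂)
    dot-combination = ℤ-Solver.solve-∀

-- The embedding of ℤ in ℚ

ℚ-ring : AlmostCommutativeRing 0ℓ 0ℓ
ℚ-ring = fromCommutativeRing +-*-commutativeRing zero?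
  where
  zero? : ∀ p → Maybe (0ℚ ≡ p)
  zero? p with 0ℚ ≟ p
  ... | yes 0≡p = just 0≡p
  ... | no _    = nothing

ι : ℤ → ℚ
ι i = i / 1

private
  -- `i / 1` is normalised through a gcd and is stuck for a variable `i`. This explicit normal form
  -- computes, so arithmetic and order can be read off the numerator.
  integral : ℤ → ℚ
  integral i = mkℚ i 0 (Coprime.sym (Coprime.1-coprimeTo ℤ.∣ i ∣))

  ι≡integral : ∀ i → ι i ≡ integral i
  ι≡integral i = ↥p/↧p≡p (integral i)

ι-+ : ∀ i j → ι (i ℤ.+ j) ≡ ι i + ι j
ι-+ i j = trans
  (cong ι (sym (cong₂ ℤ._+_ (ℤ.*-identityʳ i) (ℤ.*-identityʳ j))))
  (sym (cong₂ _+_ (ι≡integral i) (ι≡integral j)))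

ι-* : ∀ i j → ι (i ℤ.* j) ≡ ι i * ι j
ι-* i j = sym (cong₂ _*_ (ι≡integral i) (ι≡integral j))

ι-neg : ∀ i → ι (ℤ.- i) ≡ - ι i
ι-neg i = begin
  ι (ℤ.- i)                     ≡⟨ +-identityʳ _ ⟨
  ι (ℤ.- i) + 0ℚ                ≡⟨ cong (ι (ℤ.- i) +_) (+-inverseʳ (ι i)) ⟨
  ι (ℤ.- i) + (ι i + - ι i)     ≡⟨ +-assoc (ι (ℤ.- i)) (ι i) (- ι i) ⟨
  ι (ℤ.- i) + ι i + - ι i       ≡⟨ cong (_+ - ι i) (ι-+ (ℤ.- i) i) ⟨
  ι (ℤ.- i ℤ.+ i) + - ι i       ≡⟨ cong (λ k → ι k + - ι i) (ℤ.+-inverseˡ i) ⟩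
  0ℚ + - ι i                    ≡⟨ +-identityˡ _ ⟩
  - ι i                         ∎
  where open ≡-Reasoning

ι-mono-< : ∀ {i j} → i ℤ.< j → ι i < ι j
ι-mono-< {i} {j} i<j rewrite ι≡integral i | ι≡integral j =
  *<* (subst₂ ℤ._<_ (sym (ℤ.*-identityʳ i)) (sym (ℤ.*-identityʳ j)) i<j)

ι-cancel-< : ∀ {i j} → ι i < ι j → i ℤ.< j
ι-cancel-< {i} {j} ιi<ιj rewrite ι≡integral i | ι≡integral j =
  subst₂ ℤ._<_ (ℤ.*-identityʳ i) (ℤ.*-identityʳ j) (drop-*<* ιi<ιj)

ι-injective : ∀ {i j} → ι i ≡ ι j → i ≡ j
ι-injective {i} {j} eq =
  cong ↥_ (trans (sym (ι≡integral i)) (trans eq (ι≡integral j)))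

-- Ordered-field inequalities

p≤∣p∣ : ∀ p → p ≤ ∣ p ∣
p≤∣p∣ p with ≤-total 0ℚ p
... | inj₁ 0≤p = ≤-reflexive (sym (0≤p⇒∣p∣≡p 0≤p))
... | inj₂ p≤0 = ≤-trans p≤0 (0≤∣p∣ p)

-p≤∣p∣ : ∀ p → - p ≤ ∣ p ∣
-p≤∣p∣ p = subst (- p ≤_) (∣-p∣≡∣p∣ p) (p≤∣p∣ (- p))

*-pos : ∀ {p q} → 0ℚ < p → 0ℚ < q → 0ℚ < p * q
*-pos {p} {q} 0<p 0<q = positive⁻¹ _ {{pos*pos⇒pos p {{positive 0<p}} q {{positive 0<q}}}}

*-nonNeg : ∀ {p q} → 0ℚ ≤ p → 0ℚ ≤ q → 0ℚ ≤ p * q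
*-nonNeg {p} {q} 0≤p 0≤q =
  nonNegative⁻¹ _ {{nonNeg*nonNeg⇒nonNeg p {{nonNegative 0≤p}} q {{nonNegative 0≤q}}}}

0≤p*p : ∀ p → 0ℚ ≤ p * p
0≤p*p p with ≤-total 0ℚ p
... | inj₁ 0≤p = *-nonNeg 0≤p 0≤p
... | inj₂ p≤0 = nonNegative⁻¹ _ {{nonPos*nonPos⇒nonPos p {{nonPositive p≤0}} p {{nonPositive p≤0}}}}

square-mono-< : ∀ {p q} → 0ℚ < p → p < q → p * p < q * q
square-mono-< {p} {q} 0<p p<q = <-trans
  (*-monoʳ-<-pos p {{positive 0<p}} p<q)
  (*-monoˡ-<-pos q {{positive (<-trans 0<p p<q)}} p<q)

square-cancel-< : ∀ {p e} → 0ℚ < e → p * p < e * e → ∣ p ∣ < e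
square-cancel-< {p} {e} 0<e pp<ee = ≰⇒> λ e≤∣p∣ → <-irrefl refl (begin-strict
  p * p           <⟨ pp<ee ⟩
  e * e           ≤⟨ *-monoˡ-≤-nonNeg e {{nonNegative (<⇒≤ 0<e)}} e≤∣p∣ ⟩
  e * ∣ p ∣       ≤⟨ *-monoʳ-≤-nonNeg ∣ p ∣ {{nonNegative (0≤∣p∣ p)}} e≤∣p∣ ⟩
  ∣ p ∣ * ∣ p ∣   ≡⟨ ∣p*q∣≡∣p∣*∣q∣ p p ⟨
  ∣ p * p ∣       ≡⟨ 0≤p⇒∣p∣≡p (0≤p*p p) ⟩
  p * p           ∎)
  where open ≤-Reasoning

quotient : ∀ p {q} → q ≢ 0ℚ → ∃ λ r → p ≡ r * q
quotient p {q} q≢0 = p * (1/ q) {{nz}} , sym (trans (*-assoc p _ q)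
    (trans (cong (p *_) (*-inverseˡ q {{nz}})) (*-identityʳ p)))
  where
  nz : NonZero q
  nz = ≢-nonZero q≢0

0≤q-p : ∀ {p q} → p ≤ q → 0ℚ ≤ q - p
0≤q-p {p} {q} p≤q = subst (_≤ q - p) (+-inverseʳ p) (+-monoˡ-≤ (- p) p≤q)

-- Separation by a slope

-- Each `z` is viewed as the point `(c z , d z)`, and a line of slope `r` through the origin is
-- sought with finitely many such points on or below it. The hypotheses exclude points on the
-- positive vertical axis and pairs that force contradictory slopes.
module _ {Z : Set} (c d : Z → ℚ) (S : Pred Z ℓ)
  (no-ray : ∀ {z} → z ∈ S → c z ≡ 0ℚ → d z ≤ 0ℚ)
  (no-straddling : ∀ {u v} → u ∈ S → v ∈ S → 0ℚ < c u → c v < 0ℚ → c u * d v ≤ c v * d u)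
  where

  open Data.List.Extrema (DecTotalOrder.totalOrder ≤-decTotalOrder)

  -- If c z > 0, then r * c z - d z ≥ 0 means that r is at least the slope
  -- d z / c z; if c z < 0, that r is at most this slope.
  private
    Lower Upper : Pred ℚ ℓ
    Lower r = ∃ λ u → u ∈ S × 0ℚ < c u × d u ≡ r * c u
    Upper r = ∃ λ v → v ∈ S × c v < 0ℚ × d v ≡ r * c v

    -- Division of `no-straddling` by the negative product `c u * c v` reverses it into a comparison
    -- of slopes.
    lower≤upper : ∀ {l h} → l ∈ Lower → h ∈ Upper → l ≤ h
    lower≤upper {l} {h} (u , u∈S , 0<cu , du≡) (v , v∈S , cv<0 , dv≡) =
      *-cancelˡ-≤-neg (c u * c v)
        {{pos*neg⇒neg (c u) {{positive 0<cu}} (c v) {{negative cv<0}}}}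
        (subst₂ _≤_
          (trans (cong (c u *_) dv≡) (swap₁ (c u) h (c v)))
          (trans (cong (c v *_) du≡) (swap₂ (c u) l (c v)))
          (no-straddling u∈S v∈S 0<cu cv<0))
      where
      swap₁ : ∀ x r y → x * (r * y) ≡ x * y * r
      swap₁ = solve-∀ ℚ-ring
      swap₂ : ∀ x r y → y * (r * x) ≡ x * y * r
      swap₂ = solve-∀ ℚ-ring

    factor : ∀ λ′ r c → λ′ * c - r * c ≡ (λ′ - r) * c
    factor = solve-∀ ℚ-ring

    at-0 : ∀ λ′ y → - y ≡ λ′ * 0ℚ - y
    at-0 = solve-∀ ℚ-ring

    -- Every `z` with `c z` nonzero contributes one bound on the slope, lower or upper by the sign
    -- of `c z`. If `c z` vanishes, `no-ray` gives the inequality for every slope.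
    slopes : ∀ {L} → All S L → ∃ λ ls → ∃ λ hs → All Lower ls × All Upper hs ×
      (∀ λ′ → All (_≤ λ′) ls → All (λ′ ≤_) hs → All (λ z → 0ℚ ≤ λ′ * c z - d z) L)
    slopes [] = [] , [] , [] , [] , λ _ _ _ → []
    slopes (_∷_ {x = z} z∈S SL) with slopes SL | <-cmp (c z) 0ℚ
    ... | ls , hs , Ls , Hs , sep | tri≈ _ cz≡0 _ = ls , hs , Ls , Hs , λ λ′ l h →
      subst (λ r → 0ℚ ≤ λ′ * r - d z) (sym cz≡0)
        (subst (0ℚ ≤_) (at-0 λ′ (d z)) (neg-antimono-≤ (no-ray z∈S cz≡0)))
      ∷ sep λ′ l h
    ... | ls , hs , Ls , Hs , sep | tri< cz<0 cz≢0 _ =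
      let r , dz≡ = quotient (d z) cz≢0 in
      ls , r ∷ hs , Ls , (z , z∈S , cz<0 , dz≡) ∷ Hs , λ { λ′ l (λ≤r ∷ h) →
        subst (0ℚ ≤_) (trans (sym (factor λ′ r (c z))) (cong (λ s → λ′ * c z - s) (sym dz≡)))
          (nonNegative⁻¹ _ {{nonPos*nonPos⇒nonPos (λ′ - r)
            {{nonPositive (subst (λ′ - r ≤_) (+-inverseʳ r) (+-monoˡ-≤ (- r) λ≤r))}}
            (c z) {{nonPositive (<⇒≤ cz<0)}}}})
        ∷ sep λ′ l h }
    ... | ls , hs , Ls , Hs , sep | tri> _ cz≢0 0<cz =
      let r , dz≡ = quotient (d z) cz≢0 in
      r ∷ ls , hs , (z , z∈S , 0<cz , dz≡) ∷ Ls , Hs , λ { λ′ (r≤λ ∷ l) h →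
        subst (0ℚ ≤_) (trans (sym (factor λ′ r (c z))) (cong (λ s → λ′ * c z - s) (sym dz≡)))
          (*-nonNeg (0≤q-p r≤λ) (<⇒≤ 0<cz))
        ∷ sep λ′ l h }

  -- min 0ℚ hs is the value to use when there is no lower bound.
  separating-slope : ∀ {L} → All S L → ∃ λ r → All (λ z → 0ℚ ≤ r * c z - d z) L
  separating-slope SL =
    let ls , hs , Ls , Hs , sep = slopes SL
        m = min 0ℚ hs
    in max m ls
     , sep (max m ls) (xs≤max m ls)
         (All.tabulate λ h∈hs → max≤v⁺ (All.lookup (min≤xs 0ℚ hs) h∈hs)
           (All.map (λ l → lower≤upper l (All.lookup Hs h∈hs)) Ls))

-- Null and non-negative sequences

eventually-map : {P : Pred ℕ ℓ} {Q : Pred ℕ ℓ′} → P ⊆ Q → Eventually P → Eventually Q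
eventually-map f (N , h) = N , λ n n≥N → f (h n n≥N)

eventually-∩ : {P : Pred ℕ ℓ} {Q : Pred ℕ ℓ′} → Eventually P → Eventually Q → Eventually (P ∩ Q)
eventually-∩ (M , g) (N , h) = M ℕ.⊔ N , λ n n≥ →
  g n (ℕ.m⊔n≤o⇒m≤o M N n≥) , h n (ℕ.m⊔n≤o⇒n≤o M N n≥)

-- `x ≈ᴿ y` unfolds to `Null` of the difference, and `0ᴿ ≤ᴿ t` to `NonNeg (seq t)`, so both apply to
-- real numbers without conversion.
Null NonNeg : Pred (ℕ → ℚ) _
Null   s = ∀ ε → 0ℚ < ε → Eventually λ n → ∣ s n ∣ < ε
NonNeg s = ∀ ε → 0ℚ < ε → Eventually λ n → 0ℚ < s n + ε

null-ext : ∀ {s t} → (∀ n → s n ≡ t n) → Null s → Null t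
null-ext s≡t hs ε 0<ε = eventually-map (λ {n} → subst (λ r → ∣ r ∣ < ε) (s≡t n)) (hs ε 0<ε)

nonNeg-ext : ∀ {s t} → (∀ n → s n ≡ t n) → NonNeg s → NonNeg t
nonNeg-ext s≡t hs ε 0<ε = eventually-map (λ {n} → subst (λ r → 0ℚ < r + ε) (s≡t n)) (hs ε 0<ε)

null-0 : Null (λ _ → 0ℚ)
null-0 ε 0<ε = 0 , λ _ _ → 0<ε

null-+ : ∀ s t → Null s → Null t → Null (λ n → s n + t n)
null-+ s t hs ht ε 0<ε = eventually-map
  (λ {n} (s< , t<) → ≤-<-trans (∣p+q∣≤∣p∣+∣q∣ (s n) (t n))
                       (subst (_ <_) (halves ε) (+-mono-< s< t<)))
  (eventually-∩ (hs (½ * ε) (0<½* 0<ε)) (ht (½ * ε) (0<½* 0<ε)))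

null-* : ∀ x {t} → Null t → Null (λ n → seq x n * t n)
null-* x {t} ht ε 0<ε =
  let B , 0<B , s-bounded = bounded (cauchy x)
      δ , 0<δ , Bδ≡ε = divide 0<B 0<ε
  in eventually-map
       (λ {n} (s< , t<) → subst (_ <_) Bδ≡ε (∣*∣-< (seq x n) (t n) 0<B s< t<))
       (eventually-∩ s-bounded (ht δ 0<δ))

nonNeg-+ : ∀ s t → NonNeg s → NonNeg t → NonNeg (λ n → s n + t n)
nonNeg-+ s t hs ht ε 0<ε = eventually-map
  (λ {n} (0<s , 0<t) → subst (0ℚ <_)
    (trans (regroup (s n) (t n) (½ * ε)) (cong ((s n + t n) +_) (halves ε)))
    (+-mono-< 0<s 0<t))
  (eventually-∩ (hs (½ * ε) (0<½* 0<ε)) (ht (½ * ε) (0<½* 0<ε)))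
  where
  regroup : ∀ s t e → (s + e) + (t + e) ≡ (s + t) + (e + e)
  regroup = solve-∀ ℚ-ring

null⇒nonNeg : ∀ {s} → Null s → NonNeg s
null⇒nonNeg {s} hs ε 0<ε = eventually-map
  (λ {n} s< → subst (_< s n + ε) (+-inverseʳ (s n))
    (+-monoʳ-< (s n) (≤-<-trans (-p≤∣p∣ (s n)) s<)))
  (hs ε 0<ε)

-- Slacks make both factors positive, and expanding `(s + η) * (t + θ)` leaves an error of at most
-- `B * θ + (C + θ) * η`. The choice of `η` depends on `θ`, so `θ` is fixed first; each term is then
-- half of `ε`.
nonNeg-* : ∀ x y → NonNeg (seq x) → NonNeg (seq y) → NonNeg (λ n → seq x n * seq y n)
nonNeg-* x y hx hy ε 0<ε =
  let B , 0<B , x-bounded = bounded (cauchy x)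
      C , 0<C , y-bounded = bounded (cauchy y)
      θ , 0<θ , Bθ≡ = divide 0<B (0<½* 0<ε)
      η , 0<η , Dη≡ = divide {C + θ} (+-mono-< 0<C 0<θ) (0<½* 0<ε)
  in eventually-map
       (λ {n} ((x< , y<) , (0<x+η , 0<y+θ)) →
         let s = seq x n
             t = seq y n
         in begin-strict
           0ℚ                                <⟨ *-pos 0<x+η 0<y+θ ⟩
           (s + η) * (t + θ)                 ≡⟨ expand s t η θ ⟩
           s * t + (s * θ + (t + θ) * η)     ≤⟨ +-monoʳ-≤ (s * t) (+-mono-≤
             (*-monoʳ-≤-nonNeg θ {{nonNegative (<⇒≤ 0<θ)}} (≤-trans (p≤∣p∣ s) (<⇒≤ x<)))
             (*-monoʳ-≤-nonNeg η {{nonNegative (<⇒≤ 0<η)}}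
               (+-monoˡ-≤ θ (≤-trans (p≤∣p∣ t) (<⇒≤ y<))))) ⟩
           s * t + (B * θ + (C + θ) * η)     ≡⟨ cong (s * t +_) (cong₂ _+_ Bθ≡ Dη≡) ⟩
           s * t + (½ * ε + ½ * ε)           ≡⟨ cong (s * t +_) (halves ε) ⟩
           s * t + ε                         ∎)
       (eventually-∩ (eventually-∩ x-bounded y-bounded) (eventually-∩ (hx η 0<η) (hy θ 0<θ)))
  where
  open ≤-Reasoning
  expand : ∀ s t η θ → (s + η) * (t + θ) ≡ s * t + (s * θ + (t + θ) * η)
  expand = solve-∀ ℚ-ring

nonNeg-const⁻¹ : ∀ {q} → NonNeg (λ _ → q) → 0ℚ ≤ q
nonNeg-const⁻¹ {q} h = ≮⇒≥ λ q<0 →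
  let N , 0<q-q = h (- q) (neg-antimono-< q<0)
  in <-irrefl (sym (+-inverseʳ q)) (0<q-q N ℕ.≤-refl)

nonNeg-const : ∀ {q} → 0ℚ ≤ q → NonNeg (λ _ → q)
nonNeg-const 0≤q ε 0<ε = 0 , λ _ _ → +-mono-≤-< 0≤q 0<ε

≈ᴿ-pointwise : ∀ {x y} → (∀ n → seq x n ≡ seq y n) → x ≈ᴿ y
≈ᴿ-pointwise {x} {y} x≡y = null-ext
  (λ n → sym (trans (cong (_- seq y n) (x≡y n)) (+-inverseʳ (seq y n)))) null-0

1-t-nonNeg : ∀ {t} → t ≤ᴿ 1ᴿ → NonNeg (seq (1ᴿ -ᴿ t))
1-t-nonNeg {t} t≤1 ε 0<ε = eventually-map
  (λ {n} t<1+ε → subst₂ _<_ (+-inverseʳ (seq t n)) (swap (seq t n) ε)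
    (+-monoˡ-< (- seq t n) t<1+ε))
  (t≤1 ε 0<ε)
  where
  swap : ∀ t e → 1ℚ + e - t ≡ 1ℚ - t + e
  swap = solve-∀ ℚ-ring

-- Linear functionals on the plane

linear : ℚ × ℚ → ℝ² → ℝ
linear (f₁ , f₂) (p₁ , p₂) = fromℚ f₁ *ᴿ p₁ +ᴿ fromℚ f₂ *ᴿ p₂

-- The constant value of the sequence `linear f (toℝ² z)`.
linearℤ : ℚ × ℚ → ℤ² → ℚ
linearℤ (f₁ , f₂) (z₁ , z₂) = f₁ * ι z₁ + f₂ * ι z₂

linear-lineAt : ∀ f t p q n →
  seq (1ᴿ -ᴿ t) n * seq (linear f p) n + seq t n * seq (linear f q) n
  ≡ seq (linear f (lineAt t p q)) n
linear-lineAt (f₁ , f₂) t (p₁ , p₂) (q₁ , q₂) n =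
  identity f₁ f₂ (seq t n) (seq p₁ n) (seq p₂ n) (seq q₁ n) (seq q₂ n)
  where
  identity : ∀ f₁ f₂ t p₁ p₂ q₁ q₂ →
    (1ℚ - t) * (f₁ * p₁ + f₂ * p₂) + t * (f₁ * q₁ + f₂ * q₂)
    ≡ f₁ * ((1ℚ - t) * p₁ + t * q₁) + f₂ * ((1ℚ - t) * p₂ + t * q₂)
  identity = solve-∀ ℚ-ring

linear-≈ : ∀ f {p q} → p ≈² q → Null (λ n → seq (linear f q) n - seq (linear f p) n)
linear-≈ (f₁ , f₂) {p₁ , p₂} {q₁ , q₂} (p₁≈q₁ , p₂≈q₂) = null-ext
  (λ n → identity f₁ f₂ (seq p₁ n) (seq p₂ n) (seq q₁ n) (seq q₂ n))
  (null-+ _ _ (null-* (fromℚ (- f₁)) p₁≈q₁) (null-* (fromℚ (- f₂)) p₂≈q₂))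
  where
  identity : ∀ f₁ f₂ p₁ p₂ q₁ q₂ →
    (- f₁) * (p₁ - q₁) + (- f₂) * (p₂ - q₂)
    ≡ (f₁ * q₁ + f₂ * q₂) - (f₁ * p₁ + f₂ * p₂)
  identity = solve-∀ ℚ-ring

add-difference : ∀ x y → x + (y - x) ≡ y
add-difference = solve-∀ ℚ-ring

linear-null-resp : ∀ f {p q} → p ≈² q → Null (seq (linear f p)) → Null (seq (linear f q))
linear-null-resp f {p} {q} p≈q h =
  null-ext (λ n → add-difference (seq (linear f p) n) (seq (linear f q) n)) (null-+ (seq (linear f p)) (λ n → seq (linear f q) n - seq (linear f p) n)
      h (linear-≈ f {p} {q} p≈q))

linear-nonNeg-resp : ∀ f {p q} → p ≈² q → NonNeg (seq (linear f p)) → NonNeg (seq (linear f q))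
linear-nonNeg-resp f {p} {q} p≈q h =
  nonNeg-ext (λ n → add-difference (seq (linear f p) n) (seq (linear f q) n))
    (nonNeg-+ (seq (linear f p)) (λ n → seq (linear f q) n - seq (linear f p) n)
      h (null⇒nonNeg (linear-≈ f {p} {q} p≈q)))

-- Convex and affine hulls

Conv⊆Aff : {U : Pred ℝ² ℓ} → Conv U ⊆ Aff U
Conv⊆Aff (incl p∈U)          = incl p∈U
Conv⊆Aff (segment t _ _ p q) = line t (Conv⊆Aff p) (Conv⊆Aff q)
Conv⊆Aff (resp p≈q p)        = resp p≈q (Conv⊆Aff p)

Aff-inhabited : {U : Pred ℝ² ℓ} → ∀ {p} → p ∈ Aff U → ∃ U
Aff-inhabited (incl p∈U)   = _ , p∈U
Aff-inhabited (line _ p _) = Aff-inhabited p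
Aff-inhabited (resp _ p)   = Aff-inhabited p

-- The kernel of a functional is an affine subspace: null sequences are stable under multiplication
-- by any real, so the parameter of `line` may be arbitrary.
Aff-null : {U : Pred ℝ² ℓ} → ∀ f → (∀ {p} → p ∈ U → Null (seq (linear f p))) →
           ∀ {p} → p ∈ Aff U → Null (seq (linear f p))
Aff-null f h (incl p∈U) = h p∈U
Aff-null f h (line {p} {q} t p∈ q∈) = null-ext (linear-lineAt f t p q)
  (null-+ (λ n → seq (1ᴿ -ᴿ t) n * seq (linear f p) n) (λ n → seq t n * seq (linear f q) n)
    (null-* (1ᴿ -ᴿ t) (Aff-null f h p∈)) (null-* t (Aff-null f h q∈)))
Aff-null f h (resp {p} {q} p≈q p∈) = linear-null-resp f {p} {q} p≈q (Aff-null f h p∈)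

-- Duality in place of Carathéodory's theorem: a finite part of S already
-- forces the half-plane inequalities at a given point of the hull.
Conv-finitely-supported : {S : Pred ℤ² ℓ} → ∀ {p} → p ∈ Conv ⟦ S ⟧ →
  ∃ λ L → All S L ×
    (∀ f → All (λ z → 0ℚ ≤ linearℤ f z) L → NonNeg (seq (linear f p)))
Conv-finitely-supported (incl {p} (z , z∈S , z≈p)) = z ∷ [] , z∈S ∷ [] , λ { f (0≤ ∷ []) →
  linear-nonNeg-resp f {toℝ² z} {p} z≈p (nonNeg-const 0≤) }
Conv-finitely-supported (segment {p} {q} t 0≤t t≤1 p∈ q∈) =
  let L , SL , hL = Conv-finitely-supported p∈
      M , SM , hM = Conv-finitely-supported q∈
  in L ++ M , All.++⁺ SL SM , λ f 0≤ → nonNeg-ext (linear-lineAt f t p q)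
       (nonNeg-+ (λ n → seq (1ᴿ -ᴿ t) n * seq (linear f p) n) (λ n → seq t n * seq (linear f q) n)
         (nonNeg-* (1ᴿ -ᴿ t) (linear f p) (1-t-nonNeg {t} t≤1) (hL f (All.++⁻ˡ L 0≤)))
         (nonNeg-* t (linear f q) 0≤t (hM f (All.++⁻ʳ L 0≤))))
Conv-finitely-supported (resp {p} {q} p≈q p∈) =
  let L , SL , hL = Conv-finitely-supported p∈
  in L , SL , λ f 0≤ → linear-nonNeg-resp f {p} {q} p≈q (hL f 0≤)

-- From the relative interior to the group

ι-dot : ∀ x y → ι (dot x y) ≡ ι (proj₁ x) * ι (proj₁ y) + ι (proj₂ x) * ι (proj₂ y)
ι-dot (x₁ , x₂) (y₁ , y₂) =
  trans (ι-+ (x₁ ℤ.* y₁) (x₂ ℤ.* y₂)) (cong₂ _+_ (ι-* x₁ y₁) (ι-* x₂ y₂))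

ι-det : ∀ x y → ι (det x y) ≡ ι (proj₁ x) * ι (proj₂ y) - ι (proj₂ x) * ι (proj₁ y)
ι-det (x₁ , x₂) (y₁ , y₂) =
  trans (ι-+ (x₁ ℤ.* y₂) (ℤ.- (x₂ ℤ.* y₁)))
        (cong₂ _+_ (ι-* x₁ y₂) (trans (ι-neg (x₂ ℤ.* y₁)) (cong -_ (ι-* x₂ y₁))))

toℝ²∈⟦⟧ : {S : Pred ℤ² ℓ} → ∀ {z} → z ∈ S → toℝ² z ∈ ⟦ S ⟧
toℝ²∈⟦⟧ {z = z₁ , z₂} z∈S =
  (z₁ , z₂) , z∈S , ≈ᴿ-pointwise {fromℤ z₁} {fromℤ z₁} (λ _ → refl) , ≈ᴿ-pointwise {fromℤ z₂} {fromℤ z₂} (λ _ → refl)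

module _ {S : Pred ℤ² ℓ} (S-sub : IsSubmonoid S) {x : ℤ²} (x∈S : x ∈ S) (⊖x∉S : ⊖ x ∉ S) where

  private
    x₁ = proj₁ x
    x₂ = proj₂ x

  -- The functional is `x` plus `r` times its quarter turn. Its value at `z` is
  -- `dot x z + r * det x z`, that is `r * c z - d z`, so a separating slope serves as `r`.
  separating-functional : ∀ {L} → All S L →
    ∃ λ r → All (λ z → 0ℚ ≤ linearℤ (ι x₁ - r * ι x₂ , ι x₂ + r * ι x₁) z) L
  separating-functional SL =
    let r , 0≤ = separating-slope c d S no-ray no-straddling SL
    in r , All.map (λ {z} → subst (0ℚ ≤_) (value r z)) 0≤
    where
    c d : ℤ² → ℚ
    c z = ι (det x z)
    d z = ι (ℤ.- dot x z)

    no-ray : ∀ {z} → z ∈ S → c z ≡ 0ℚ → d z ≤ 0ℚ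
    -- Otherwise `z` would point in the direction of `- x`.
    no-ray z∈S cz≡0 = ≮⇒≥ λ 0<dz → ⊖x∉S
      (⊖∈-of-opposite S-sub x∈S z∈S (ι-injective cz≡0) (ℤ.neg-cancel-< (ι-cancel-< 0<dz)))

    flip : ∀ i j → ℤ.- (i ℤ.* (ℤ.- j)) ≡ i ℤ.* j
    flip = ℤ-Solver.solve-∀

    no-straddling : ∀ {u v} → u ∈ S → v ∈ S → 0ℚ < c u → c v < 0ℚ → c u * d v ≤ c v * d u
    no-straddling {u} {v} u∈S v∈S 0<cu cv<0 = ≮⇒≥ λ lt → ⊖x∉S
      (⊖∈-of-straddling S-sub x∈S u∈S v∈S (ι-cancel-< 0<cu) (ι-cancel-< cv<0)
        (subst₂ ℤ._<_ (flip (det x u) (dot x v)) (flip (det x v) (dot x u))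
          (ℤ.neg-mono-< (ι-cancel-<
            (subst₂ _<_ (sym (ι-* (det x v) _)) (sym (ι-* (det x u) _)) lt)))))

    value : ∀ r z → r * c z - d z ≡ linearℤ (ι x₁ - r * ι x₂ , ι x₂ + r * ι x₁) z
    value r z@(z₁ , z₂) = trans
      (cong₂ (λ p q → r * p - q) (ι-det x z) (trans (ι-neg (dot x z)) (cong -_ (ι-dot x z))))
      (identity r (ι x₁) (ι x₂) (ι z₁) (ι z₂))
      where
      identity : ∀ r x₁ x₂ z₁ z₂ →
        r * (x₁ * z₂ - x₂ * z₁) - (- (x₁ * z₁ + x₂ * z₂))
        ≡ (x₁ - r * x₂) * z₁ + (x₂ + r * x₁) * z₂
      identity = solve-∀ ℚ-ring

  0<normSq : 0ℚ < ι (dot x x)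
  -- If `x` were `O`, then `⊖ x` would compute to `O`, which lies in `S` by `x∈S`.
  0<normSq = ι-mono-< (dot-pos x λ { refl → ⊖x∉S x∈S })

  -- The point is `- δ x`. A functional that is non-negative on its finite support takes the value
  -- `- δ |x|²` there, because the term in `r` vanishes along `x`.
  negative-multiple∉Conv : ∀ {δ} → 0ℚ < δ →
    lineAt (fromℚ (- δ)) (toℝ² O) (toℝ² x) ∉ Conv ⟦ S ∖ ｛ O ｝ ⟧
  negative-multiple∉Conv {δ} 0<δ p∈ =
    let L , SL , hL = Conv-finitely-supported p∈
        r , 0≤      = separating-functional (All.map proj₁ SL)
        f           = ι x₁ - r * ι x₂ , ι x₂ + r * ι x₁
        h           = nonNeg-ext (λ _ → value r) (hL f 0≤)
    in <-irrefl refl (<-≤-trans (neg-antimono-< (*-pos 0<δ 0<normSq)) (nonNeg-const⁻¹ h))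
    where
    identity : ∀ r δ x₁ x₂ →
      (x₁ - r * x₂) * ((1ℚ - (- δ)) * 0ℚ + (- δ) * x₁)
        + (x₂ + r * x₁) * ((1ℚ - (- δ)) * 0ℚ + (- δ) * x₂)
      ≡ - (δ * (x₁ * x₁ + x₂ * x₂))
    identity = solve-∀ ℚ-ring
    value : ∀ r → _ ≡ - (δ * ι (dot x x))
    value r = trans (identity r δ (ι x₁) (ι x₂)) (cong (λ k → - (δ * k)) (sym (ι-dot x x)))

-- Let `K = |x|²` and let `η` be an eventual lower bound of `ε`. With `(1 + K) δ = η`, the squared
-- distance `K δ²` plus the gap `δ²` is at most `((1 + K) δ)² = η²`, which is less than `ε²`.
small-multiple : ∀ x ε → 0ᴿ <ᴿ ε → ∃ λ δ → 0ℚ < δ ×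
  distSq (toℝ² O) (lineAt (fromℚ (- δ)) (toℝ² O) (toℝ² x)) <ᴿ ε *ᴿ ε
small-multiple x@(x₁ , x₂) ε (η , 0<η , ev) =
  let K = ι x₁ * ι x₁ + ι x₂ * ι x₂
      0≤K : 0ℚ ≤ K
      0≤K = +-mono-≤ (0≤p*p (ι x₁)) (0≤p*p (ι x₂))
      δ , 0<δ , Kδ≡η = divide {1ℚ + K} (+-mono-<-≤ (positive⁻¹ 1ℚ) 0≤K) 0<η
      0<δδ = *-pos 0<δ 0<δ
  in δ , 0<δ , δ * δ , 0<δδ , eventually-map
       (λ {n} η<ε → begin-strict
         _                                 ≡⟨ expand δ (ι x₁) (ι x₂) ⟩
         1ℚ * ((1ℚ + K) * (δ * δ))         ≤⟨ *-monoʳ-≤-nonNeg ((1ℚ + K) * (δ * δ))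
             {{nonNegative (*-nonNeg (+-mono-≤ (<⇒≤ (positive⁻¹ 1ℚ)) 0≤K) (<⇒≤ 0<δδ))}}
             (+-monoʳ-≤ 1ℚ 0≤K) ⟩
         (1ℚ + K) * ((1ℚ + K) * (δ * δ))   ≡⟨ square (1ℚ + K) δ ⟩
         (1ℚ + K) * δ * ((1ℚ + K) * δ)     ≡⟨ cong₂ _*_ Kδ≡η Kδ≡η ⟩
         η * η                             <⟨ square-mono-< 0<η (subst (_< seq ε n) (+-identityˡ η) η<ε) ⟩
         seq ε n * seq ε n                 ∎)
       ev
  where
  open ≤-Reasoning
  expand : ∀ δ x₁ x₂ →
    (0ℚ - ((1ℚ - (- δ)) * 0ℚ + (- δ) * x₁)) * (0ℚ - ((1ℚ - (- δ)) * 0ℚ + (- δ) * x₁))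
      + (0ℚ - ((1ℚ - (- δ)) * 0ℚ + (- δ) * x₂)) * (0ℚ - ((1ℚ - (- δ)) * 0ℚ + (- δ) * x₂))
      + δ * δ
    ≡ 1ℚ * ((1ℚ + (x₁ * x₁ + x₂ * x₂)) * (δ * δ))
  expand = solve-∀ ℚ-ring
  square : ∀ k δ → k * (k * (δ * δ)) ≡ k * δ * (k * δ)
  square = solve-∀ ℚ-ring

nonTrivialGroup-of-relInt : {S : Pred ℤ² ℓ} → ExcludedMiddle ℓ → IsSubmonoid S →
  toℝ² O ∈ RelInt (Conv ⟦ S ∖ ｛ O ｝ ⟧) → IsSubgroup S × NonTrivial S
nonTrivialGroup-of-relInt {S = S} em S-sub (O∈Aff , ε , 0<ε , ball) =
  record { isSubmonoid = S-sub ; ⊖-closed = ⊖-closed } , nonTrivial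
  where
  nonTrivial : NonTrivial S
  nonTrivial =
    -- Hulls of the empty set are empty, so a point of the affine hull of the convex hull leads back
    -- to an element of `S ∖ ｛ O ｝`.
    let _ , p∈Conv       = Aff-inhabited O∈Aff
        _ , z , z∈S∖O , _ = Aff-inhabited (Conv⊆Aff p∈Conv)
    in z , z∈S∖O

  ⊖-closed : ∀ {x} → x ∈ S → ⊖ x ∈ S
  ⊖-closed {x} x∈S with ≡-dec ℤ._≟_ ℤ._≟_ O x | em {⊖ x ∈ S}
  ... | yes refl | _        = IsSubmonoid.O∈ S-sub
  ... | no _     | yes ⊖x∈S = ⊖x∈S
  ... | no O≢x   | no ⊖x∉S  =
    let δ , 0<δ , near = small-multiple x ε 0<ε
    in contradiction
         -- The affine hull contains the whole line through `O` and `x`, in particular its point at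
         -- the negative parameter `- δ`.
         (ball _ (line (fromℚ (- δ)) O∈Aff (incl (incl (toℝ²∈⟦⟧ (x∈S , O≢x))))) near)
         (negative-multiple∉Conv S-sub x∈S ⊖x∉S 0<δ)

-- Neighbourhoods of O in the hull of a group

coordinates-small : ∀ {e} → 0ℚ < e → ∀ q → distSq (toℝ² O) q <ᴿ fromℚ e *ᴿ fromℚ e →
  Eventually λ n → ∣ seq (proj₁ q) n ∣ < e × ∣ seq (proj₂ q) n ∣ < e
coordinates-small {e} 0<e (q₁ , q₂) (η , 0<η , ev) = eventually-map
  (λ {n} lt → square-cancel-< 0<e (≤-<-trans (drop₁ (seq q₁ n) (seq q₂ n)) (squares {seq q₁ n} {seq q₂ n} lt))
            , square-cancel-< 0<e (≤-<-trans (drop₂ (seq q₁ n) (seq q₂ n)) (squares {seq q₁ n} {seq q₂ n} lt)))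
  ev
  where
  identity : ∀ x y → (0ℚ - x) * (0ℚ - x) + (0ℚ - y) * (0ℚ - y) ≡ x * x + y * y
  identity = solve-∀ ℚ-ring
  squares : ∀ {x y} → (0ℚ - x) * (0ℚ - x) + (0ℚ - y) * (0ℚ - y) + η < e * e →
            x * x + y * y < e * e
  squares {x} {y} lt = <-trans
    (subst (_< x * x + y * y + η) (+-identityʳ _) (+-monoʳ-< (x * x + y * y) 0<η))
    (subst (λ r → r + η < e * e) (identity x y) lt)
  drop₁ : ∀ x y → x * x ≤ x * x + y * y
  drop₁ x y = subst (_≤ x * x + y * y) (+-identityʳ _) (+-monoʳ-≤ (x * x) (0≤p*p y))
  drop₂ : ∀ x y → y * y ≤ x * x + y * y
  drop₂ x y = subst (_≤ x * x + y * y) (+-identityˡ _) (+-monoˡ-≤ (y * y) (0≤p*p x))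

∣_∣₁ : ℚ × ℚ → ℚ
∣ f₁ , f₂ ∣₁ = ∣ f₁ ∣ + ∣ f₂ ∣

0≤∣f∣₁ : ∀ f → 0ℚ ≤ ∣ f ∣₁
0≤∣f∣₁ (f₁ , f₂) = +-mono-≤ (0≤∣p∣ f₁) (0≤∣p∣ f₂)

∣linear∣≤ : ∀ f {e} p n → ∣ seq (proj₁ p) n ∣ < e → ∣ seq (proj₂ p) n ∣ < e →
            ∣ seq (linear f p) n ∣ ≤ ∣ f ∣₁ * e
∣linear∣≤ (f₁ , f₂) {e} (p₁ , p₂) n p₁< p₂< = begin
  ∣ f₁ * seq p₁ n + f₂ * seq p₂ n ∣               ≤⟨ ∣p+q∣≤∣p∣+∣q∣ (f₁ * seq p₁ n) (f₂ * seq p₂ n) ⟩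
  ∣ f₁ * seq p₁ n ∣ + ∣ f₂ * seq p₂ n ∣           ≤⟨ +-mono-≤ (term f₁ p₁<) (term f₂ p₂<) ⟩
  ∣ f₁ ∣ * e + ∣ f₂ ∣ * e                         ≡⟨ *-distribʳ-+ e ∣ f₁ ∣ ∣ f₂ ∣ ⟨
  (∣ f₁ ∣ + ∣ f₂ ∣) * e                           ∎
  where
  open ≤-Reasoning
  term : ∀ g {q} → ∣ q ∣ < e → ∣ g * q ∣ ≤ ∣ g ∣ * e
  term g {q} q< = subst (_≤ ∣ g ∣ * e) (sym (∣p*q∣≡∣p∣*∣q∣ g q))
    (*-monoˡ-≤-nonNeg ∣ g ∣ {{nonNegative (0≤∣p∣ g)}} (<⇒≤ q<))

AtMost½ : Pred ℝ _
AtMost½ x = Eventually λ n → ∣ seq x n ∣ ≤ ½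

small-functionals : ∀ f g → ∃ λ e → 0ℚ < e ×
  (∀ q → distSq (toℝ² O) q <ᴿ fromℚ e *ᴿ fromℚ e → AtMost½ (linear f q) × AtMost½ (linear g q))
small-functionals f g =
  -- One radius serves both functionals; the summand `1ℚ` keeps the divisor positive even if both
  -- are zero.
  let e , 0<e , Ke≡½ = divide {1ℚ + (∣ f ∣₁ + ∣ g ∣₁)} 0<K (positive⁻¹ ½)
      bound : ∀ h → ∣ h ∣₁ ≤ 1ℚ + (∣ f ∣₁ + ∣ g ∣₁) → ∀ q →
              distSq (toℝ² O) q <ᴿ fromℚ e *ᴿ fromℚ e → AtMost½ (linear h q)
      bound h h≤ q near = eventually-map
        (λ {n} (q₁< , q₂<) → ≤-trans (∣linear∣≤ h q n q₁< q₂<)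
          (subst (∣ h ∣₁ * e ≤_) Ke≡½ (*-monoʳ-≤-nonNeg e {{nonNegative (<⇒≤ 0<e)}} h≤)))
        (coordinates-small 0<e q near)
  in e , 0<e , λ q near → bound f f≤ q near , bound g g≤ q near
  where
  0≤1 : 0ℚ ≤ 1ℚ
  0≤1 = <⇒≤ (positive⁻¹ 1ℚ)
  0<K : 0ℚ < 1ℚ + (∣ f ∣₁ + ∣ g ∣₁)
  0<K = +-mono-<-≤ (positive⁻¹ 1ℚ) (+-mono-≤ (0≤∣f∣₁ f) (0≤∣f∣₁ g))
  f≤ : ∣ f ∣₁ ≤ 1ℚ + (∣ f ∣₁ + ∣ g ∣₁)
  f≤ = subst (_≤ 1ℚ + (∣ f ∣₁ + ∣ g ∣₁)) (trans (+-identityˡ _) (+-identityʳ _))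
         (+-mono-≤ 0≤1 (+-monoʳ-≤ ∣ f ∣₁ (0≤∣f∣₁ g)))
  g≤ : ∣ g ∣₁ ≤ 1ℚ + (∣ f ∣₁ + ∣ g ∣₁)
  g≤ = subst (_≤ 1ℚ + (∣ f ∣₁ + ∣ g ∣₁)) (trans (+-identityˡ _) (+-identityˡ _))
         (+-mono-≤ 0≤1 (+-monoˡ-≤ ∣ g ∣₁ (0≤∣f∣₁ f)))

infixr 7 _•_
_•_ : ℝ → ℤ² → ℝ²
s • (z₁ , z₂) = s *ᴿ fromℤ z₁ , s *ᴿ fromℤ z₂

infixl 6 _+²_
_+²_ : ℝ² → ℝ² → ℝ²
(p₁ , p₂) +² (q₁ , q₂) = p₁ +ᴿ q₁ , p₂ +ᴿ q₂

module _ {S : Pred ℤ² ℓ} (S-group : IsSubgroup S) where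

  open IsSubgroup S-group
  open IsSubmonoid isSubmonoid

  private
    U : Pred ℝ² ℓ
    U = Conv ⟦ S ∖ ｛ O ｝ ⟧

  O≢⊖ : ∀ {x} → O ≢ x → O ≢ ⊖ x
  O≢⊖ {x₁ , x₂} O≢x O≡⊖x = O≢x (cong₂ _,_
    (ℤ.neg-injective (cong proj₁ O≡⊖x)) (ℤ.neg-injective (cong proj₂ O≡⊖x)))

  -- The point `s x` lies on the segment from `- x` to `x`, at the parameter `(1 + s) / 2`.
  segment⊆Conv : ∀ {x} → x ∈ S → O ≢ x → ∀ s →
                 (Eventually λ n → ∣ seq s n ∣ ≤ 1ℚ) → s • x ∈ U
  segment⊆Conv {x@(x₁ , x₂)} x∈S O≢x s s≤1 = resp
    {p = lineAt t (toℝ² (⊖ x)) (toℝ² x)}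
    (≈ᴿ-pointwise {proj₁ (lineAt t (toℝ² (⊖ x)) (toℝ² x))} {s *ᴿ fromℤ x₁} (λ n → coordinate (seq s n) x₁)
    , ≈ᴿ-pointwise {proj₂ (lineAt t (toℝ² (⊖ x)) (toℝ² x))} {s *ᴿ fromℤ x₂} (λ n → coordinate (seq s n) x₂))
    (segment t
      (λ ε 0<ε → eventually-map (λ {n} s≤ → +-mono-≤-< (lower s≤) 0<ε) s≤1)
      (λ ε 0<ε → eventually-map
        (λ {n} s≤ → subst (_< 1ℚ + ε) (+-identityʳ _) (+-mono-≤-< (upper s≤) 0<ε)) s≤1)
      (incl (toℝ²∈⟦⟧ (⊖-closed x∈S , O≢⊖ O≢x)))
      (incl (toℝ²∈⟦⟧ (x∈S , O≢x))))
    where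
    t : ℝ
    t = fromℚ ½ *ᴿ (1ᴿ +ᴿ s)
    lower : ∀ {r} → ∣ r ∣ ≤ 1ℚ → 0ℚ ≤ ½ * (1ℚ + r)
    lower {r} r≤ = *-nonNeg (<⇒≤ (positive⁻¹ ½)) (subst (_≤ 1ℚ + r) (+-inverseˡ r)
      (+-monoˡ-≤ r (≤-trans (-p≤∣p∣ r) r≤)))
    upper : ∀ {r} → ∣ r ∣ ≤ 1ℚ → ½ * (1ℚ + r) ≤ 1ℚ
    upper {r} r≤ = *-monoˡ-≤-nonNeg ½ (+-monoʳ-≤ 1ℚ (≤-trans (p≤∣p∣ r) r≤))
    identity : ∀ s y → (1ℚ - ½ * (1ℚ + s)) * (- y) + ½ * (1ℚ + s) * y ≡ s * y
    identity = solve-∀ ℚ-ring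
    coordinate : ∀ s i → (1ℚ - ½ * (1ℚ + s)) * ι (ℤ.- i) + ½ * (1ℚ + s) * ι i ≡ s * ι i
    coordinate s i = trans (cong (λ r → (1ℚ - ½ * (1ℚ + s)) * r + ½ * (1ℚ + s) * ι i) (ι-neg i))
                           (identity s (ι i))

  -- The point is the midpoint of `2 s x` and `2 t y`, which lie in the hull by `segment⊆Conv`;
  -- hence the bound ½ on the coefficients.
  parallelogram⊆Conv : ∀ {x y} → x ∈ S → O ≢ x → y ∈ S → O ≢ y → ∀ s t →
                       AtMost½ s → AtMost½ t → s • x +² t • y ∈ U
  parallelogram⊆Conv {x@(x₁ , x₂)} {y@(y₁ , y₂)} x∈S O≢x y∈S O≢y s t s≤ t≤ = resp
    {p = lineAt (fromℚ ½) ((s +ᴿ s) • x) ((t +ᴿ t) • y)}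
    (≈ᴿ-pointwise {proj₁ (lineAt (fromℚ ½) ((s +ᴿ s) • x) ((t +ᴿ t) • y))} {proj₁ (s • x +² t • y)}
       (λ n → identity (seq s n) (seq t n) (ι x₁) (ι y₁))
    , ≈ᴿ-pointwise {proj₂ (lineAt (fromℚ ½) ((s +ᴿ s) • x) ((t +ᴿ t) • y))} {proj₂ (s • x +² t • y)}
       (λ n → identity (seq s n) (seq t n) (ι x₂) (ι y₂)))
    (segment (fromℚ ½) (nonNeg-const (<⇒≤ (positive⁻¹ ½)))
      (λ ε 0<ε → 0 , λ _ _ → subst (_< 1ℚ + ε) (+-identityʳ ½) (+-mono-< ½<1 0<ε))
      (segment⊆Conv x∈S O≢x (s +ᴿ s) (doubled {s} s≤))
      (segment⊆Conv y∈S O≢y (t +ᴿ t) (doubled {t} t≤)))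
    where
    ½<1 : ½ < 1ℚ
    ½<1 = subst (_< 1ℚ) (+-identityʳ ½) (+-monoʳ-< ½ (positive⁻¹ ½))
    doubled : ∀ {r} → AtMost½ r → Eventually λ n → ∣ seq (r +ᴿ r) n ∣ ≤ 1ℚ
    doubled {r} = eventually-map λ {n} r≤ →
      ≤-trans (∣p+q∣≤∣p∣+∣q∣ (seq r n) (seq r n)) (+-mono-≤ r≤ r≤)
    identity : ∀ s t x y → (1ℚ - ½) * ((s + s) * x) + ½ * ((t + t) * y) ≡ s * x + t * y
    identity = solve-∀ ℚ-ring

  -- As `O` is removed from `S`, it is recovered as the midpoint of `- x` and `x`.
  O∈Conv : ∀ {x} → x ∈ S → O ≢ x → toℝ² O ∈ U
  O∈Conv {x₁ , x₂} x∈S O≢x = resp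
    (≈ᴿ-pointwise {0ᴿ *ᴿ fromℤ x₁} {fromℤ 0ℤ} (λ _ → *-zeroˡ (ι x₁))
    , ≈ᴿ-pointwise {0ᴿ *ᴿ fromℤ x₂} {fromℤ 0ℤ} (λ _ → *-zeroˡ (ι x₂)))
    (segment⊆Conv x∈S O≢x 0ᴿ (0 , λ _ _ → <⇒≤ (positive⁻¹ 1ℚ)))

  relInt-of-ball : ∀ {x e} → x ∈ S → O ≢ x → 0ℚ < e →
    (∀ q → q ∈ Aff U → distSq (toℝ² O) q <ᴿ fromℚ e *ᴿ fromℚ e → q ∈ U) →
    toℝ² O ∈ RelInt U
  relInt-of-ball {e = e} x∈S O≢x 0<e ball =
    incl (O∈Conv x∈S O≢x) , fromℚ e
    , (½ * e , 0<½* 0<e , 0 , λ _ _ → subst (0ℚ + ½ * e <_) (halves e) (+-monoˡ-< (½ * e) (0<½* 0<e)))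
    , ball

  relInt-of-rank2 : ∀ {x y} → x ∈ S → y ∈ S → det x y ≢ 0ℤ → toℝ² O ∈ RelInt U
  relInt-of-rank2 {x@(x₁ , x₂)} {y@(y₁ , y₂)} x∈S y∈S det≢0 =
    -- Here `i` is the inverse of `det x y`, and `f`, `g` form the basis dual to `x`, `y`: by
    -- Cramer's rule, `q = f(q) x + g(q) y`.
    let i , 1≡iD = quotient 1ℚ {ι (det x y)} (det≢0 ∘ ι-injective)
        f = i * ι y₂ , - (i * ι y₁)
        g = - (i * ι x₂) , i * ι x₁
        cramer : ∀ z → z * (i * (ι x₁ * ι y₂ - ι x₂ * ι y₁)) ≡ z
        cramer z = trans (cong (z *_) (trans (cong (i *_) (sym (ι-det x y))) (sym 1≡iD)))
                         (*-identityʳ z)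
        e , 0<e , small = small-functionals f g
    in relInt-of-ball x∈S O≢x 0<e λ q@(q₁ , q₂) _ near →
       let s≤ , t≤ = small q near in resp
         (≈ᴿ-pointwise {proj₁ (linear f q • x +² linear g q • y)} {q₁} (λ n → trans
           (first i (ι x₁) (ι x₂) (ι y₁) (ι y₂) (seq q₁ n) (seq q₂ n)) (cramer (seq q₁ n)))
         , ≈ᴿ-pointwise {proj₂ (linear f q • x +² linear g q • y)} {q₂} (λ n → trans
           (second i (ι x₁) (ι x₂) (ι y₁) (ι y₂) (seq q₁ n) (seq q₂ n)) (cramer (seq q₂ n))))
         (parallelogram⊆Conv x∈S O≢x y∈S O≢y (linear f q) (linear g q) s≤ t≤)
    where
    O≢x : O ≢ x
    O≢x refl = det≢0 refl
    cancel : ∀ j k → j ℤ.* 0ℤ ℤ.- k ℤ.* 0ℤ ≡ 0ℤ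
    cancel = ℤ-Solver.solve-∀
    O≢y : O ≢ y
    O≢y refl = det≢0 (cancel x₁ x₂)
    first : ∀ i x₁ x₂ y₁ y₂ q₁ q₂ →
      (i * y₂ * q₁ + (- (i * y₁)) * q₂) * x₁ + ((- (i * x₂)) * q₁ + i * x₁ * q₂) * y₁
      ≡ q₁ * (i * (x₁ * y₂ - x₂ * y₁))
    first = solve-∀ ℚ-ring
    second : ∀ i x₁ x₂ y₁ y₂ q₁ q₂ →
      (i * y₂ * q₁ + (- (i * y₁)) * q₂) * x₂ + ((- (i * x₂)) * q₁ + i * x₁ * q₂) * y₂
      ≡ q₂ * (i * (x₁ * y₂ - x₂ * y₁))
    second = solve-∀ ℚ-ring

  -- With `f(q) = x·q / |x|²`, the coefficient of the orthogonal projection to the line of `x`, the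
  -- coordinates of `f(q) x - q` are multiples of `det x q`, which is null on the affine hull.
  relInt-of-rank1 : ∀ {x} → x ∈ S → O ≢ x → (∀ {y} → y ∈ S → det x y ≡ 0ℤ) →
                    toℝ² O ∈ RelInt U
  relInt-of-rank1 {x@(x₁ , x₂)} x∈S O≢x collinear =
    let i , 1≡iN = quotient 1ℚ {ι (dot x x)} (λ eq → <⇒≢ (ι-mono-< (dot-pos x O≢x)) (sym eq))
        f = i * ι x₁ , i * ι x₂
        project : ∀ z → i * (ι x₁ * ι x₁ + ι x₂ * ι x₂) * z ≡ z
        project z = trans (cong (_* z) (trans (cong (i *_) (sym (ι-dot x x))) (sym 1≡iN)))
                          (*-identityˡ z)
        e , 0<e , small = small-functionals f f
    in relInt-of-ball x∈S O≢x 0<e λ q@(q₁ , q₂) q∈Aff near → resp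
         (null-ext
            (λ n → trans (first i (ι x₁) (ι x₂) (seq q₁ n) (seq q₂ n))
                         (cong (λ r → seq (linear f q) n * ι x₁ - r) (project (seq q₁ n))))
            (null-* (fromℚ (i * ι x₂)) (det-null q∈Aff))
         , null-ext
            (λ n → trans (second i (ι x₁) (ι x₂) (seq q₁ n) (seq q₂ n))
                         (cong (λ r → seq (linear f q) n * ι x₂ - r) (project (seq q₂ n))))
            (null-* (fromℚ (- (i * ι x₁))) (det-null q∈Aff)))
         (segment⊆Conv x∈S O≢x (linear f q)
           (eventually-map (λ {n} s≤½ → ≤-trans s≤½ ½≤1) (proj₁ (small q near))))
    where
    ½≤1 : ½ ≤ 1ℚ
    ½≤1 = +-monoʳ-≤ ½ {0ℚ} {½} (<⇒≤ (positive⁻¹ ½))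
    -- The functional sending `q` to `det x q`.
    rotated : ℚ × ℚ
    rotated = - ι x₂ , ι x₁
    swap : ∀ x₁ x₂ z₁ z₂ → x₁ * z₂ - x₂ * z₁ ≡ (- x₂) * z₁ + x₁ * z₂
    swap = solve-∀ ℚ-ring
    det-null : ∀ {q} → q ∈ Aff U → Null (seq (linear rotated q))
    -- `U` is itself a hull, so the kernel argument runs twice: for `Aff U`, and for `U` inside the
    -- affine hull of the lattice points.
    det-null = Aff-null rotated λ p∈U → Aff-null rotated
      (λ { {p} (z@(z₁ , z₂) , (z∈S , _) , z≈p) → linear-null-resp rotated {toℝ² z} {p} z≈p
        (null-ext (λ _ → trans (cong ι (sym (collinear z∈S)))
                               (trans (ι-det x z) (swap (ι x₁) (ι x₂) (ι z₁) (ι z₂))))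
          null-0) })
      (Conv⊆Aff p∈U)
    first : ∀ i x₁ x₂ q₁ q₂ →
      i * x₂ * ((- x₂) * q₁ + x₁ * q₂)
      ≡ (i * x₁ * q₁ + i * x₂ * q₂) * x₁ - i * (x₁ * x₁ + x₂ * x₂) * q₁
    first = solve-∀ ℚ-ring
    second : ∀ i x₁ x₂ q₁ q₂ →
      (- (i * x₁)) * ((- x₂) * q₁ + x₁ * q₂)
      ≡ (i * x₁ * q₁ + i * x₂ * q₂) * x₂ - i * (x₁ * x₁ + x₂ * x₂) * q₂
    second = solve-∀ ℚ-ring

-- The rank dichotomy and the equivalence

relInt-of-nonTrivialGroup : {S : Pred ℤ² ℓ} → ExcludedMiddle ℓ →
  IsSubgroup S → NonTrivial S → toℝ² O ∈ RelInt (Conv ⟦ S ∖ ｛ O ｝ ⟧)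
relInt-of-nonTrivialGroup {S = S} em S-group (x , x∈S , O≢x)
  -- Excluded middle decides whether `S` has an element independent of `x`, that is, whether it has
  -- rank 2 or 1.
  with em {∃ λ y → y ∈ S × det x y ≢ 0ℤ}
... | yes (y , y∈S , det≢0) = relInt-of-rank2 S-group x∈S y∈S det≢0
... | no ¬independent = relInt-of-rank1 S-group x∈S O≢x λ {y} y∈S →
  decidable-stable (det x y ℤ.≟ 0ℤ) λ det≢0 → ¬independent (y , y∈S , det≢0)

proposition3p11 :
    ∀ {a b : Level} → ExcludedMiddle (a ⊔ b) →
    (X : Pred ℤ² a) → StepSet X →
    (C : Pred ℤ² b) → IsSubmonoid C →
    (IsSubgroup 𝓐[ X , C ] × NonTrivial 𝓐[ X , C ])
      ⇔ (toℝ² O ∈ RelInt (Conv ⟦ 𝓐[ X , C ] ∖ ｛ O ｝ ⟧))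
proposition3p11 em X _ C C-sub = mk⇔
  (λ (group , nonTrivial) → relInt-of-nonTrivialGroup em group nonTrivial)
  (nonTrivialGroup-of-relInt em (𝓐-isSubmonoid {X = X} C-sub))
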